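{- For every $n\in\mathbf{N}=\{0,1,2,\ldots\}$, the number of disjoint Schröder $n$-families is $2^{\binom{n}{2}}$.
   Context: A Schröder-type path from $p$ to $q$ (with $p,q\in\mathbf{Z}\times\mathbf{Z}$) is a sequence $P=(p_0,p_1,\ldots,p_k)$ with $k\in\mathbf{N}$, $p_i\in\mathbf{Z}\times\mathbf{Z}$ for $0\le i\le k$, $p_0=p$, $p_k=q$, and $p_{i+1}-p_i\in\{(0,+1),(-1,+1),(-1,0)\}$ for $0\le i<k$. Its support is $\operatorname{supp}(P)=\{p_0,\ldots,p_k\}$. For $n\in\mathbf{N}$, an $n$-family is an $n$-tuple $(P_0,P_1,\ldots,P_{n-1})$ where, for each $0\le i<n$, $P_i$ is a Schröder-type path from $(i,0)$ to $(0,i)$. It is disjoint if the sets $\operatorname{supp}(P_0),\ldots,\operatorname{supp}(P_{n-1})$ are pairwise disjoint. It is a Schröder $n$-family if for each $i$ and each point $(k,l)\in\operatorname{supp}(P_i)$ one has $k+l\ge i$. A disjoint Schröder $n$-family is an $n$-family that is both disjoint and a Schröder $n$-family. -}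

module Defs where

open import Data.Fin using (Fin; toℕ)
open import Data.Integer using (ℤ; +_; -[1+_]; _+_; _-_; _≥_)
open import Data.List using ([]; _∷_)
open import Data.List.Membership.Propositional using () renaming (_∈_ to _∈ˡ_)
open import Data.List.NonEmpty using (List⁺; head; last; toList)
open import Data.List.Relation.Unary.Linked using (Linked)
open import Data.Nat using (ℕ)
open import Data.Product using (Σ; _×_; _,_; proj₁)
open import Data.Vec using (Vec; lookup)
open import Level using (0ℓ)
open import Relation.Binary using (Rel; Setoid)
import Relation.Binary.Construct.On as On
open import Relation.Binary.PropositionalEquality using (_≡_; _≢_; setoid)
open import Relation.Unary using (Pred; _∈_; _⊥_)

Point : Set
Point = ℤ × ℤ

_-ᵖ_ : Point → Point → Point
(x , y) -ᵖ (x′ , y′) = x - x′ , y - y′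

Step : Rel Point 0ℓ
Step p q = (q -ᵖ p) ∈ˡ
  ((+ 0 , + 1) ∷ (-[1+ 0 ] , + 1) ∷ (-[1+ 0 ] , + 0) ∷ [])

record IsPath (p q : Point) (P : List⁺ Point) : Set where
  field
    starts : head P ≡ p
    ends   : last P ≡ q
    steps  : Linked Step (toList P)

supp : List⁺ Point → Pred Point 0ℓ
supp P p = p ∈ˡ toList P

module _ {n : ℕ} (F : Vec (List⁺ Point) n) where

  IsFamily : Set
  IsFamily = ∀ (i : Fin n) →
    IsPath (+ toℕ i , + 0) (+ 0 , + toℕ i) (lookup F i)

  IsDisjoint : Set
  IsDisjoint = ∀ (i j : Fin n) → i ≢ j → supp (lookup F i) ⊥ supp (lookup F j)

  IsSchröder : Set
  IsSchröder = ∀ (i : Fin n) (k l : ℤ) →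
    (k , l) ∈ supp (lookup F i) → k + l ≥ + toℕ i

  record IsDisjointSchröderFamily : Set where
    field
      isFamily   : IsFamily
      isDisjoint : IsDisjoint
      isSchröder : IsSchröder

-- Two families are equal when their underlying tuples of point sequences are;
-- the accompanying proofs are ignored, so that each family counts once.
DisjointSchröderFamilies : ℕ → Setoid 0ℓ 0ℓ
DisjointSchröderFamilies n =
  On.setoid {B = Σ (Vec (List⁺ Point) n) IsDisjointSchröderFamily}
    (setoid (Vec (List⁺ Point) n)) proj₁

{-# OPTIONS --safe #-}
module Submission where

-- A path meets each vertical line in an interval, so a disjoint family is read
-- off column by column as an alternating chain: the exit heights B of a column
-- turn into the entry heights of the next one by adding 0 or 1 to each (Moves),
-- and entry heights interlace with exit heights of the same column (Interlaced).
-- Locally the two relations commute up to a factor 2 (upDown-swap). Moving all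
-- Moves to the empty end of the chain costs 1 + 2 + ... + (n - 1) swaps, and
-- what remains, an n-fold Interlaced chain ending in (0, ..., n - 1), is unique.
-- The Schröder condition holds automatically for disjoint families.

open import Defs
open import Data.Empty using (⊥; ⊥-elim)
open import Data.Fin using (Fin; zero; suc; toℕ)
open import Data.Fin.Properties using (*↔×; 1↔⊤; suc-injective)
import Data.Integer as ℤ
import Data.Integer.Properties as ℤ
open import Data.List using (List; []; _∷_; map; initLast; _∷ʳ′_)
open import Data.List.Membership.Propositional using (_∈_)
open import Data.List.Membership.Propositional.Properties using (∈-map⁺; ∈-map⁻)
open import Data.List.NonEmpty using (List⁺; _∷_; last; toList)
open import Data.List.Properties using (∷-injectiveˡ; ∷-injectiveʳ; map-injective)
open import Data.List.Relation.Unary.Linked using (Linked; [-]; _∷_)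
open import Data.List.Relation.Unary.Any using (here; there)
open import Data.Nat
  using (ℕ; zero; suc; _+_; _^_; _≤_; _<_; z≤n; s≤s; s≤s⁻¹; _≤‴_; ≤‴-refl; ≤‴-step)
open import Data.Nat.Combinatorics using (_C_; nCk+nC[k+1]≡[n+1]C[k+1]; nC1≡n)
open import Data.Nat.Properties hiding (suc-injective)
open import Data.Product using (Σ; Σ-syntax; _×_; _,_; proj₁; proj₂)
open import Data.Product.Function.Dependent.Propositional using (Σ-↔)
open import Data.Product.Function.NonDependent.Propositional using (_×-↔_)
open import Data.Sum using (_⊎_; inj₁; inj₂)
open import Data.Unit using (⊤; tt)
open import Data.Vec using (Vec; []; _∷_; head; lookup)
import Data.Vec.Properties as Vec
open import Function.Bundles using (Inverse; _↔_; mk↔ₛ′)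
open import Function.Construct.Composition using (inverse)
open import Function.Properties.Inverse using (↔-refl; ↔-sym; ↔-trans)
open import Function.Related.TypeIsomorphisms using (×-comm)
open import Relation.Binary.Definitions using (tri<; tri≈; tri>)
open import Relation.Binary.PropositionalEquality
  using (_≡_; refl; sym; trans; cong; cong₂; subst; setoid)
open import Relation.Nullary using (¬_; Irrelevant)
open import Relation.Nullary.Decidable using (yes; no)

-- Bijections between types with few elements.

private
  variable
    m : ℕ
    X Y Z : Set

empty-↔ : ¬ X → ¬ Y → X ↔ Y
empty-↔ ¬x ¬y = mk↔ₛ′ (λ x → ⊥-elim (¬x x)) (λ y → ⊥-elim (¬y y))
  (λ y → ⊥-elim (¬y y)) (λ x → ⊥-elim (¬x x))

contractible-↔ : Irrelevant X → X → X ↔ ⊤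
contractible-↔ irr x = mk↔ₛ′ (λ _ → tt) (λ _ → x) (λ _ → refl) (irr x)

⊎-both : Irrelevant X → Irrelevant Y → X → Y → (X ⊎ Y) ↔ Fin 2
⊎-both irrX irrY x y = mk↔ₛ′
  (λ { (inj₁ _) → zero ; (inj₂ _) → suc zero })
  (λ { zero → inj₁ x ; (suc zero) → inj₂ y })
  (λ { zero → refl ; (suc zero) → refl })
  (λ { (inj₁ x′) → cong inj₁ (irrX x x′) ; (inj₂ y′) → cong inj₂ (irrY y y′) })

⊎-onlyˡ : Irrelevant X → X → ¬ Y → (X ⊎ Y) ↔ ⊤
⊎-onlyˡ irr x ¬y = contractible-↔
  (λ { (inj₁ a) (inj₁ b) → cong inj₁ (irr a b)
     ; (inj₁ _) (inj₂ b) → ⊥-elim (¬y b)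
     ; (inj₂ a) _ → ⊥-elim (¬y a) })
  (inj₁ x)

⊎-onlyʳ : Irrelevant Y → ¬ X → Y → (X ⊎ Y) ↔ ⊤
⊎-onlyʳ irr ¬x y = contractible-↔
  (λ { (inj₂ a) (inj₂ b) → cong inj₂ (irr a b)
     ; (inj₂ _) (inj₁ b) → ⊥-elim (¬x b)
     ; (inj₁ a) _ → ⊥-elim (¬x a) })
  (inj₂ y)

×-contractibleˡ : X ↔ ⊤ → Y ↔ Z → (X × Y) ↔ Z
×-contractibleˡ x↔⊤ y↔z = ↔-trans (x↔⊤ ×-↔ y↔z)
  (mk↔ₛ′ proj₂ (tt ,_) (λ _ → refl) (λ _ → refl))

×-irrelevant : Irrelevant X → Irrelevant Y → Irrelevant (X × Y)
×-irrelevant irrX irrY (x , y) (x′ , y′) = cong₂ _,_ (irrX x x′) (irrY y y′)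

-- Commutation of the two relations

-- The heights before and after a step into the next column: `left` is the step (-1, 0), `diag` the
-- step (-1, +1).
data _↝_ (b : ℕ) : ℕ → Set where
  left : b ↝ b
  diag : b ↝ suc b

-- Exit heights B of a column against entry heights of the next one, the
-- latter lowered by 1.
Moves : Vec ℕ m → Vec ℕ m → Set
Moves [] [] = ⊤
Moves (b ∷ B) (a ∷ A) = (b ↝ suc a) × Moves B A

-- Entry heights A (lowered by 1) against exit heights B of the same column;
-- B has one more entry, for the path that starts in that column at height 0.
Interlaced : Vec ℕ m → Vec ℕ (suc m) → Set
Interlaced [] (b ∷ []) = ⊤
Interlaced (a ∷ A) (b ∷ b′ ∷ B) = (b ≤ a × a < b′) × Interlaced A (b′ ∷ B)

IncreasingFrom : ℕ → Vec ℕ m → Set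
IncreasingFrom x [] = ⊤
IncreasingFrom x (a ∷ A) = x ≤ a × IncreasingFrom (suc a) A

increasing-weaken : ∀ {x y} (A : Vec ℕ m) → y ≤ x → IncreasingFrom x A → IncreasingFrom y A
increasing-weaken [] _ _ = tt
increasing-weaken (_ ∷ _) y≤x (x≤a , inc) = ≤-trans y≤x x≤a , inc

interlaced-sourceˡ : ∀ {x} (A : Vec ℕ m) b (B : Vec ℕ m) → x ≤ b →
  Interlaced A (b ∷ B) → IncreasingFrom x A
interlaced-sourceˡ [] _ _ _ _ = tt
interlaced-sourceˡ (a ∷ A) b (b′ ∷ B) x≤b ((b≤a , a<b′) , i) =
  ≤-trans x≤b b≤a , interlaced-sourceˡ A b′ B a<b′ i

interlaced-targetˡ : ∀ {x} (A : Vec ℕ m) b (B : Vec ℕ m) → x ≤ b →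
  Interlaced A (b ∷ B) → IncreasingFrom x (b ∷ B)
interlaced-targetˡ [] _ [] x≤b _ = x≤b , tt
interlaced-targetˡ (a ∷ A) b (b′ ∷ B) x≤b ((b≤a , a<b′) , i) =
  x≤b , interlaced-targetˡ A b′ B (≤-trans (s≤s b≤a) a<b′) i

interlaced-source : (A : Vec ℕ m) (B : Vec ℕ (suc m)) → Interlaced A B → IncreasingFrom 0 A
interlaced-source A (b ∷ B) = interlaced-sourceˡ A b B z≤n

interlaced-target : (A : Vec ℕ m) (B : Vec ℕ (suc m)) → Interlaced A B → IncreasingFrom 0 B
interlaced-target A (b ∷ B) = interlaced-targetˡ A b B z≤n

interlaced-irrelevant : (A : Vec ℕ m) (B : Vec ℕ (suc m)) → Irrelevant (Interlaced A B)
interlaced-irrelevant [] (_ ∷ []) _ _ = refl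
interlaced-irrelevant (_ ∷ A) (_ ∷ b ∷ B) =
  ×-irrelevant (×-irrelevant ≤-irrelevant ≤-irrelevant) (interlaced-irrelevant A (b ∷ B))

-- The bound `lo` serves the induction: once the first entry `a` of `A` is removed, the condition
-- `a < b′` survives as a bound on the head of the remaining `B`.
UpDown : ℕ → Vec ℕ m → Vec ℕ (suc m) → Set
UpDown {m} lo A D = Σ[ B ∈ Vec ℕ (suc m) ] lo ≤ head B × Interlaced A B × Moves B D

DownUp : Vec ℕ m → Vec ℕ (suc m) → Set
DownUp {m} A D = Σ[ E ∈ Vec ℕ m ] Moves A E × Interlaced E D

-- The possible values of one entry of `B`; by `↝` only `d` and `suc d` are candidates.
UpWindow : ℕ → ℕ → ℕ → Set
UpWindow lo hi d = Σ[ b ∈ ℕ ] (b ↝ suc d) × lo ≤ b × b ≤ hi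

-- The possible values of one entry of `E`; the candidates are `a` and, for positive `a`, its
-- predecessor.
DownWindow : ℕ → ℕ → ℕ → Set
DownWindow a lo hi = Σ[ e ∈ ℕ ] (a ↝ suc e) × lo ≤ e × e < hi

-- The last entry of `B` has no entry of `A` above it, so this window is bounded from below only. It
-- is the one window without a counterpart in `DownUp`.
upDown-[] : ∀ lo d → UpDown lo [] (d ∷ []) ↔ (Σ[ b ∈ ℕ ] (b ↝ suc d) × lo ≤ b)
upDown-[] lo d = mk↔ₛ′
  (λ { (b ∷ [] , lo≤b , _ , s , _) → b , s , lo≤b })
  (λ { (b , s , lo≤b) → b ∷ [] , lo≤b , tt , s , tt })
  (λ _ → refl)
  (λ { (_ ∷ [] , _) → refl })

upDown-∷ : ∀ lo a (A : Vec ℕ m) d d′ D →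
  UpDown lo (a ∷ A) (d ∷ d′ ∷ D) ↔ (UpWindow lo a d × UpDown (suc a) A (d′ ∷ D))
upDown-∷ lo a A d d′ D = mk↔ₛ′
  (λ { (b ∷ b′ ∷ B , lo≤b , ((b≤a , a<b′) , i) , s , t) →
         (b , s , lo≤b , b≤a) , (b′ ∷ B , a<b′ , i , t) })
  (λ { ((b , s , lo≤b , b≤a) , (b′ ∷ B , a<b′ , i , t)) →
         b ∷ b′ ∷ B , lo≤b , ((b≤a , a<b′) , i) , s , t })
  (λ { (_ , (_ ∷ _ , _)) → refl })
  (λ { (_ ∷ _ ∷ _ , _) → refl })

downUp-[] : ∀ d → DownUp [] (d ∷ []) ↔ ⊤
downUp-[] d = contractible-↔ (λ { ([] , _) ([] , _) → refl }) ([] , tt , tt)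

downUp-∷ : ∀ a (A : Vec ℕ m) d d′ D →
  DownUp (a ∷ A) (d ∷ d′ ∷ D) ↔ (DownWindow a d d′ × DownUp A (d′ ∷ D))
downUp-∷ a A d d′ D = mk↔ₛ′
  (λ { (e ∷ E , (s , t) , ((d≤e , e<d′) , i)) → (e , s , d≤e , e<d′) , (E , t , i) })
  (λ { ((e , s , d≤e , e<d′) , (E , t , i)) → e ∷ E , (s , t) , ((d≤e , e<d′) , i) })
  (λ _ → refl)
  (λ { (_ ∷ _ , _) → refl })

↝-sources : ∀ d (P : ℕ → Set) → (Σ[ b ∈ ℕ ] (b ↝ suc d) × P b) ↔ (P d ⊎ P (suc d))
↝-sources d P = mk↔ₛ′
  (λ { (_ , diag , p) → inj₁ p ; (_ , left , p) → inj₂ p })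
  (λ { (inj₁ p) → _ , diag , p ; (inj₂ p) → _ , left , p })
  (λ { (inj₁ _) → refl ; (inj₂ _) → refl })
  (λ { (_ , diag , _) → refl ; (_ , left , _) → refl })

↝-targets : ∀ a (P : ℕ → Set) →
  (Σ[ e ∈ ℕ ] (a ↝ suc e) × P e) ↔ (P a ⊎ (Σ[ e ∈ ℕ ] a ≡ suc e × P e))
↝-targets a P = mk↔ₛ′
  (λ { (_ , diag , p) → inj₁ p ; (e , left , p) → inj₂ (e , refl , p) })
  (λ { (inj₁ p) → _ , diag , p ; (inj₂ (e , refl , p)) → e , left , p })
  (λ { (inj₁ _) → refl ; (inj₂ (_ , refl , _)) → refl })
  (λ { (_ , diag , _) → refl ; (_ , left , _) → refl })

module _ {lo hi d : ℕ} where

  upWindow-both : lo ≤ d → d < hi → UpWindow lo hi d ↔ Fin 2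
  upWindow-both lo≤d d<hi = ↔-trans (↝-sources d _)
    (⊎-both (×-irrelevant ≤-irrelevant ≤-irrelevant) (×-irrelevant ≤-irrelevant ≤-irrelevant)
      (lo≤d , <⇒≤ d<hi) (m≤n⇒m≤1+n lo≤d , d<hi))

  upWindow-diag : lo ≤ d → d ≡ hi → UpWindow lo hi d ↔ ⊤
  upWindow-diag lo≤d refl = ↔-trans (↝-sources d _)
    (⊎-onlyˡ (×-irrelevant ≤-irrelevant ≤-irrelevant)
      (lo≤d , ≤-refl) (λ (_ , d<d) → <-irrefl refl d<d))

  upWindow-left : lo ≡ suc d → d < hi → UpWindow lo hi d ↔ ⊤
  upWindow-left refl d<hi = ↔-trans (↝-sources d _)
    (⊎-onlyʳ (×-irrelevant ≤-irrelevant ≤-irrelevant)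
      (λ (d<d , _) → <-irrefl refl d<d) (≤-refl , d<hi))

  upWindow-empty : hi < d → ¬ UpWindow lo hi d
  upWindow-empty hi<d (_ , diag , _ , b≤hi) = <⇒≱ hi<d b≤hi
  upWindow-empty hi<d (_ , left , _ , b≤hi) = <⇒≱ hi<d (<⇒≤ b≤hi)

module _ {a lo hi : ℕ} where

  downWindow-both : lo < a → a < hi → DownWindow a lo hi ↔ Fin 2
  downWindow-both (s≤s lo≤a) a<hi = ↔-trans (↝-targets a _)
    (⊎-both (×-irrelevant ≤-irrelevant ≤-irrelevant)
      (λ { (_ , refl , p) (_ , refl , q) →
             cong (λ r → _ , refl , r) (×-irrelevant ≤-irrelevant ≤-irrelevant p q) })
      (m≤n⇒m≤1+n lo≤a , a<hi) (_ , refl , lo≤a , <⇒≤ a<hi))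

  downWindow-diag : lo ≡ a → a < hi → DownWindow a lo hi ↔ ⊤
  downWindow-diag refl a<hi = ↔-trans (↝-targets a _)
    (⊎-onlyˡ (×-irrelevant ≤-irrelevant ≤-irrelevant)
      (≤-refl , a<hi) (λ { (_ , refl , e<e , _) → <-irrefl refl e<e }))

  downWindow-left : lo < a → a ≡ hi → DownWindow a lo hi ↔ ⊤
  downWindow-left (s≤s lo≤a) refl = ↔-trans (↝-targets a _)
    (⊎-onlyʳ
      (λ { (_ , refl , p) (_ , refl , q) →
             cong (λ r → _ , refl , r) (×-irrelevant ≤-irrelevant ≤-irrelevant p q) })
      (λ (_ , a<a) → <-irrefl refl a<a) (_ , refl , lo≤a , ≤-refl))

  downWindow-below : a < lo → ¬ DownWindow a lo hi
  downWindow-below a<lo (_ , diag , lo≤e , _) = <⇒≱ a<lo lo≤e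
  downWindow-below a<lo (_ , left , lo≤e , _) = <⇒≱ a<lo (m≤n⇒m≤1+n lo≤e)

  downWindow-above : hi < a → ¬ DownWindow a lo hi
  downWindow-above hi<a (_ , diag , _ , e<hi) = <-asym hi<a e<hi
  downWindow-above hi<a (_ , left , _ , e<hi) = <⇒≱ hi<a e<hi

upDown-empty : ∀ {lo d} (A : Vec ℕ m) (D : Vec ℕ m) → suc d < lo → ¬ UpDown lo A (d ∷ D)
upDown-empty A D d+1<lo (_ ∷ _ , lo≤b , _ , diag , _) = <⇒≱ (<-trans (n<1+n _) d+1<lo) lo≤b
upDown-empty A D d+1<lo (_ ∷ _ , lo≤b , _ , left , _) = <⇒≱ d+1<lo lo≤b

¬×ˡ : ¬ X → ¬ (X × Y)
¬×ˡ ¬x (x , _) = ¬x x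

¬×ʳ : ¬ Y → ¬ (X × Y)
¬×ʳ ¬y (_ , y) = ¬y y

-- Both sides are products of one window per height. An entry of A that
-- coincides with a neighbouring entry of D removes one binary choice from
-- each side; the left side has one window more, whose surplus choice is
-- carried up along A (upDown-free) unless already used up (upDown-forced).
mutual
  upDown-free : ∀ {lo d} (A D : Vec ℕ m) → lo ≤ d →
    IncreasingFrom lo A → IncreasingFrom (suc d) D →
    UpDown lo A (d ∷ D) ↔ (Fin 2 × DownUp A (d ∷ D))
  upDown-free {lo = lo} {d} [] [] lo≤d _ _ =
    ↔-trans (upDown-[] lo d)
    (↔-trans (↝-sources d _)
    (↔-trans (⊎-both ≤-irrelevant ≤-irrelevant lo≤d (m≤n⇒m≤1+n lo≤d))
    (↔-sym (↔-trans (×-comm _ _) (×-contractibleˡ (downUp-[] d) ↔-refl)))))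
  upDown-free {lo = lo} {d} (a ∷ A) (d′ ∷ D) lo≤d (_ , incA) (d<d′ , incD) =
    ↔-trans (upDown-∷ lo a A d d′ D)
    (↔-trans middle
    (↔-refl ×-↔ ↔-sym (downUp-∷ a A d d′ D)))
    where
    middle : (UpWindow lo a d × UpDown (suc a) A (d′ ∷ D)) ↔
             (Fin 2 × DownWindow a d d′ × DownUp A (d′ ∷ D))
    middle with <-cmp d a
    ... | tri< d<a _ _ = upWindow-both lo≤d d<a ×-↔ upDown-next A D d<a incA incD
    -- The exit height must be `d` and `e` must be `a`, so the surplus choice is left to the later
    -- entries.
    ... | tri≈ _ refl _ = ×-contractibleˡ (upWindow-diag lo≤d refl)
            (↔-trans (upDown-free A D d<d′ incA incD)
            (↔-refl ×-↔ ↔-sym (×-contractibleˡ (downWindow-diag refl d<d′) ↔-refl)))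
    ... | tri> _ _ a<d = empty-↔ (¬×ˡ (upWindow-empty a<d)) (¬×ʳ (¬×ˡ (downWindow-below a<d)))

  upDown-forced : ∀ {d} (A D : Vec ℕ m) →
    IncreasingFrom (suc d) A → IncreasingFrom (suc d) D →
    UpDown (suc d) A (d ∷ D) ↔ DownUp A (d ∷ D)
  upDown-forced {d = d} [] [] _ _ =
    ↔-trans (upDown-[] (suc d) d)
    (↔-trans (↝-sources d _)
    (↔-trans (⊎-onlyʳ ≤-irrelevant (<-irrefl refl) ≤-refl)
    (↔-sym (downUp-[] d))))
  upDown-forced {d = d} (a ∷ A) (d′ ∷ D) (d<a , incA) (_ , incD) =
    ↔-trans (upDown-∷ (suc d) a A d d′ D)
    (↔-trans (×-contractibleˡ (upWindow-left refl d<a) (upDown-next A D d<a incA incD))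
    (↔-sym (downUp-∷ a A d d′ D)))

  upDown-next : ∀ {a d d′} (A D : Vec ℕ m) → d < a →
    IncreasingFrom (suc a) A → IncreasingFrom (suc d′) D →
    UpDown (suc a) A (d′ ∷ D) ↔ (DownWindow a d d′ × DownUp A (d′ ∷ D))
  upDown-next {a = a} {d′ = d′} A D d<a incA incD with <-cmp a d′
  -- Both candidates for `e` are possible, and the surplus choice of the remaining `UpDown` is
  -- matched with this one.
  ... | tri< a<d′ _ _ =
        ↔-trans (upDown-free A D a<d′ incA incD) (↔-sym (downWindow-both d<a a<d′) ×-↔ ↔-refl)
  -- The bound `suc a` forces the next exit height to be `suc d′`, while `e` must be the predecessor
  -- of `a`.
  ... | tri≈ _ refl _ =
        ↔-trans (upDown-forced A D incA incD)
        (↔-sym (×-contractibleˡ (downWindow-left d<a refl) ↔-refl))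
  ... | tri> _ _ d′<a =
        empty-↔ (upDown-empty A D (s≤s d′<a)) (¬×ˡ (downWindow-above d′<a))

upDown-swap : (A : Vec ℕ m) (D : Vec ℕ (suc m)) → IncreasingFrom 0 A → IncreasingFrom 0 D →
  (Σ[ B ∈ Vec ℕ (suc m) ] Interlaced A B × Moves B D) ↔ (Fin 2 × DownUp A D)
upDown-swap A (d ∷ D) incA (_ , incD) = ↔-trans
  (mk↔ₛ′ (λ (B , q) → B , z≤n , q) (λ { (B , _ , q) → B , q })
    (λ { (B , z≤n , q) → refl }) (λ _ → refl))
  (upDown-free A D z≤n incA incD)

-- Counting chains.

-- Subtracting from each entry its index turns `Interlaced` into weak interlacing, so these are
-- Gelfand-Tsetlin patterns with longest row `B`.
Ups : ∀ m → Vec ℕ m → Set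
Ups zero [] = ⊤
Ups (suc m) B = Σ[ A ∈ Vec ℕ m ] Ups m A × Interlaced A B

UpsDown : ∀ m → Vec ℕ m → Set
UpsDown m D = Σ[ B ∈ Vec ℕ m ] Ups m B × Moves B D

-- Columns are read from right to left. In the last one `m` paths are present, with exit heights
-- `B`; `E` holds the exit heights of the column before it and `A` the lowered entry heights.
Chain : ∀ m → Vec ℕ m → Set
Chain zero [] = ⊤
Chain (suc m) B = Σ[ E ∈ Vec ℕ m ] Chain m E × (Σ[ A ∈ Vec ℕ m ] Moves E A × Interlaced A B)

ups-increasing : ∀ m (B : Vec ℕ m) → Ups m B → IncreasingFrom 0 B
ups-increasing zero [] _ = tt
ups-increasing (suc m) B (A , _ , i) = interlaced-target A B i

Fin-×-^ : ∀ k l → (Fin (2 ^ k) × Fin (2 ^ l)) ↔ Fin (2 ^ (k + l))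
Fin-×-^ k l = subst (λ n → (Fin (2 ^ k) × Fin (2 ^ l)) ↔ Fin n)
  (sym (^-distribˡ-+-* 2 k l)) (↔-sym *↔×)

-- The final `Moves` is swapped with each of the `m` interlacings in turn, at a factor 2 each, until
-- it relates empty vectors and disappears.
upsDown : ∀ m (D : Vec ℕ m) → IncreasingFrom 0 D → UpsDown m D ↔ (Fin (2 ^ m) × Ups m D)
upsDown zero [] _ = mk↔ₛ′ (λ _ → zero , tt) (λ _ → [] , tt , tt)
  (λ { (zero , _) → refl }) (λ { ([] , _) → refl })
upsDown (suc m) D inc =
  ↔-trans regroup
  (↔-trans (Σ-↔ ↔-refl (λ {A} → Σ-↔ ↔-refl (λ {u} →
      upDown-swap A D (ups-increasing m A u) inc)))
  (↔-trans regroup′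
  (↔-trans (↔-refl ×-↔ Σ-↔ ↔-refl (λ {E} → Σ-↔ ↔-refl (λ {i} →
      upsDown m E (interlaced-source E D i))))
  regroup″)))
  where
  regroup : UpsDown (suc m) D ↔
    (Σ[ A ∈ Vec ℕ m ] Ups m A × (Σ[ B ∈ Vec ℕ (suc m) ] Interlaced A B × Moves B D))
  regroup = mk↔ₛ′
    (λ (B , (A , u , i) , t) → A , u , B , i , t) (λ (A , u , B , i , t) → B , (A , u , i) , t)
    (λ _ → refl) (λ _ → refl)
  regroup′ : (Σ[ A ∈ Vec ℕ m ] Ups m A × Fin 2 × DownUp A D) ↔
    (Fin 2 × (Σ[ E ∈ Vec ℕ m ] Interlaced E D × UpsDown m E))
  regroup′ = mk↔ₛ′
    (λ (A , u , k , E , t , i) → k , E , i , A , u , t)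
    (λ (k , E , i , A , u , t) → A , u , k , E , t , i)
    (λ _ → refl) (λ _ → refl)
  regroup″ : (Fin 2 × (Σ[ E ∈ Vec ℕ m ] Interlaced E D × Fin (2 ^ m) × Ups m E)) ↔
    (Fin (2 ^ suc m) × Ups (suc m) D)
  regroup″ = ↔-trans
    (mk↔ₛ′
      (λ (k , E , i , l , u) → (k , l) , E , u , i)
      (λ ((k , l) , E , u , i) → k , E , i , l , u)
      (λ _ → refl) (λ _ → refl))
    (↔-sym *↔× ×-↔ ↔-refl)

-- By induction the chain up to `E` has no `Moves` left; the single one between `E` and `A` is then
-- pushed through `m` interlacings, which multiplies the count by `2 ^ m`.
chain↔ : ∀ m (B : Vec ℕ m) → Chain m B ↔ (Fin (2 ^ (m C 2)) × Ups m B)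
chain↔ zero [] = ↔-sym (×-contractibleˡ 1↔⊤ ↔-refl)
chain↔ (suc m) B =
  ↔-trans (Σ-↔ ↔-refl (λ {E} → chain↔ m E ×-↔ ↔-refl))
  (↔-trans regroup
  (↔-trans (↔-refl ×-↔ Σ-↔ ↔-refl (λ {A} → Σ-↔ ↔-refl (λ {i} →
      upsDown m A (interlaced-source A B i))))
  (↔-trans regroup′ (power ×-↔ ↔-refl))))
  where
  regroup : (Σ[ E ∈ Vec ℕ m ] (Fin (2 ^ (m C 2)) × Ups m E) ×
              (Σ[ A ∈ Vec ℕ m ] Moves E A × Interlaced A B)) ↔
            (Fin (2 ^ (m C 2)) × (Σ[ A ∈ Vec ℕ m ] Interlaced A B × UpsDown m A))
  regroup = mk↔ₛ′
    (λ (E , (k , u) , A , t , i) → k , A , i , E , u , t)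
    (λ (k , A , i , E , u , t) → E , (k , u) , A , t , i)
    (λ _ → refl) (λ _ → refl)
  regroup′ : (Fin (2 ^ (m C 2)) × (Σ[ A ∈ Vec ℕ m ] Interlaced A B × Fin (2 ^ m) × Ups m A)) ↔
             ((Fin (2 ^ m) × Fin (2 ^ (m C 2))) × Ups (suc m) B)
  regroup′ = mk↔ₛ′
    (λ (k , A , i , l , u) → (l , k) , A , u , i)
    (λ ((l , k) , A , u , i) → k , A , i , l , u)
    (λ _ → refl) (λ _ → refl)
  power : (Fin (2 ^ m) × Fin (2 ^ (m C 2))) ↔ Fin (2 ^ (suc m C 2))
  power = subst (λ n → (Fin (2 ^ m) × Fin (2 ^ (m C 2))) ↔ Fin (2 ^ n))
    -- Pascal's rule, with `m` read as `m C 1`.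
    (trans (cong (_+ m C 2) (sym (nC1≡n m))) (nCk+nC[k+1]≡[n+1]C[k+1] m 1))
    (Fin-×-^ m (m C 2))

-- The prescribed ends (0, i) make `range 0 n` the exit heights of column 0.
range : ℕ → ∀ m → Vec ℕ m
range x zero = []
range x (suc m) = x ∷ range (suc x) m

range-interlaced : ∀ x m → Interlaced (range x m) (range x (suc m))
range-interlaced x zero = tt
range-interlaced x (suc m) = (≤-refl , ≤-refl) , range-interlaced (suc x) m

interlaced-range : ∀ x m (A : Vec ℕ m) → Interlaced A (range x (suc m)) → A ≡ range x m
interlaced-range x zero [] _ = refl
interlaced-range x (suc m) (a ∷ A) ((x≤a , a<x+1) , i) =
  cong₂ _∷_ (≤-antisym (s≤s⁻¹ a<x+1) x≤a) (interlaced-range (suc x) m A i)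

ups-range : ∀ m → Ups m (range 0 m)
ups-range zero = tt
ups-range (suc m) = range 0 m , ups-range m , range-interlaced 0 m

ups-range-irrelevant : ∀ m → Irrelevant (Ups m (range 0 m))
ups-range-irrelevant zero _ _ = refl
ups-range-irrelevant (suc m) (A , u , i) (A′ , u′ , i′)
  with refl ← interlaced-range 0 m A i | refl ← interlaced-range 0 m A′ i′ =
  cong₂ (λ v j → A , v , j) (ups-range-irrelevant m u u′)
    (interlaced-irrelevant A (range 0 (suc m)) i i′)

chain-count : ∀ n → Chain n (range 0 n) ↔ Fin (2 ^ (n C 2))
chain-count n = ↔-trans (chain↔ n (range 0 n)) (↔-trans (×-comm _ _)
  (×-contractibleˡ (contractible-↔ (ups-range-irrelevant n) (ups-range n)) ↔-refl))

-- Lattice paths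

-- A path from (x, y) to (0, b). Natural coordinates suffice: no step raises the first coordinate or
-- lowers the second.
data Path (b : ℕ) : ℕ → ℕ → Set where
  done   : Path b 0 b
  up     : ∀ {x y} → Path b x (suc y) → Path b x y
  across : ∀ {x y y′} → y ↝ y′ → Path b x y′ → Path b (suc x) y

private
  variable
    b b′ x y a : ℕ

mutual
  points : Path b x y → List (ℕ × ℕ)
  points {x = x} {y} p = (x , y) ∷ rest p

  rest : Path b x y → List (ℕ × ℕ)
  rest done = []
  rest (up p) = points p
  rest (across _ p) = points p

path-≤ : Path b x y → y ≤ b
path-≤ done = ≤-refl
path-≤ (up p) = <⇒≤ (path-≤ p)
path-≤ (across left p) = path-≤ p
path-≤ (across diag p) = <⇒≤ (path-≤ p)

path₀-irrelevant : Irrelevant (Path b 0 y)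
path₀-irrelevant done done = refl
path₀-irrelevant done (up q) = ⊥-elim (<-irrefl refl (path-≤ q))
path₀-irrelevant (up p) done = ⊥-elim (<-irrefl refl (path-≤ p))
path₀-irrelevant (up p) (up q) = cong up (path₀-irrelevant p q)

-- `≤‴` keeps the upper end fixed and raises the lower one, which is the recursion of `up`.
vertical‴ : y ≤‴ b → Path b 0 y
vertical‴ ≤‴-refl = done
vertical‴ (≤‴-step y<b) = up (vertical‴ y<b)

vertical : y ≤ b → Path b 0 y
vertical y≤b = vertical‴ (≤⇒≤‴ y≤b)

-- The path p moved one column to the right and prolonged through column 0,
-- which it enters at height a.
extend : Path b′ x y → b′ ↝ a → a ≤ b → Path b (suc x) y
extend done s a≤b = across s (vertical a≤b)
extend (up p) s a≤b = up (extend p s a≤b)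
extend (across t p) s a≤b = across t (extend p s a≤b)

Extension : ℕ → ℕ → ℕ → Set
Extension b x y = Σ[ b′ ∈ ℕ ] Σ[ a ∈ ℕ ] Path b′ x y × (b′ ↝ a) × a ≤ b

-- Inverse to `extend`: the path is cut at its step from column 1 into column 0.
strip : Path b (suc x) y → Extension b x y
strip (up p) with b′ , a , q , s , a≤b ← strip p = b′ , a , up q , s , a≤b
strip {x = zero} (across s p) = _ , _ , done , s , path-≤ p
strip {x = suc x} (across t p) with b′ , a , q , s , a≤b ← strip p = b′ , a , across t q , s , a≤b

strip-extend : (p : Path b′ x y) (s : b′ ↝ a) (a≤b : a ≤ b) →
  strip (extend p s a≤b) ≡ (b′ , a , p , s , a≤b)
strip-extend done s a≤b = cong (λ q → _ , _ , done , s , q) (≤-irrelevant _ _)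
strip-extend (up p) s a≤b rewrite strip-extend p s a≤b = refl
strip-extend (across t p) s a≤b rewrite strip-extend p s a≤b = refl

extend-strip : (p : Path b (suc x) y) →
  let (_ , _ , q , s , a≤b) = strip p in extend q s a≤b ≡ p
extend-strip (up p) = cong up (extend-strip p)
extend-strip {x = zero} (across s p) = cong (across s) (path₀-irrelevant _ p)
extend-strip {x = suc x} (across t p) = cong (across t) (extend-strip p)

end∈points : (p : Path b x y) → (0 , b) ∈ points p
end∈points done = here refl
end∈points (up p) = there (end∈points p)
end∈points (across _ p) = there (end∈points p)

points₀⁻ : ∀ {k l} (p : Path b 0 y) → (k , l) ∈ points p → k ≡ 0 × y ≤ l × l ≤ b
points₀⁻ p (here refl) = refl , ≤-refl , path-≤ p
points₀⁻ (up p) (there l∈p) with k≡0 , y<l , l≤b ← points₀⁻ p l∈p = k≡0 , <⇒≤ y<l , l≤b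

points₀⁺ : ∀ {l} (p : Path b 0 y) → y ≤ l → l ≤ b → (0 , l) ∈ points p
points₀⁺ done y≤l l≤y with refl ← ≤-antisym y≤l l≤y = here refl
points₀⁺ (up p) y≤l l≤b with m≤n⇒m<n∨m≡n y≤l
... | inj₁ y<l = there (points₀⁺ p y<l l≤b)
... | inj₂ refl = here refl

extend-points⁻ : ∀ {k l} (p : Path b′ x y) (s : b′ ↝ a) (a≤b : a ≤ b) →
  (k , l) ∈ points (extend p s a≤b) →
  (k ≡ 0 × a ≤ l × l ≤ b) ⊎ (Σ[ j ∈ ℕ ] k ≡ suc j × (j , l) ∈ points p)
extend-points⁻ p s a≤b (here refl) = inj₂ (_ , refl , here refl)
extend-points⁻ done s a≤b (there z) = inj₁ (points₀⁻ (vertical a≤b) z)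
extend-points⁻ (up p) s a≤b (there z) with extend-points⁻ p s a≤b z
... | inj₁ w = inj₁ w
... | inj₂ (j , eq , w) = inj₂ (j , eq , there w)
extend-points⁻ (across t p) s a≤b (there z) with extend-points⁻ p s a≤b z
... | inj₁ w = inj₁ w
... | inj₂ (j , eq , w) = inj₂ (j , eq , there w)

extend-points⁺ : ∀ {j l} (p : Path b′ x y) (s : b′ ↝ a) (a≤b : a ≤ b) →
  (j , l) ∈ points p → (suc j , l) ∈ points (extend p s a≤b)
extend-points⁺ p s a≤b (here refl) = here refl
extend-points⁺ (up p) s a≤b (there z) = there (extend-points⁺ p s a≤b z)
extend-points⁺ (across t p) s a≤b (there z) = there (extend-points⁺ p s a≤b z)

extend-points₀⁺ : ∀ {l} (p : Path b′ x y) (s : b′ ↝ a) (a≤b : a ≤ b) →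
  a ≤ l → l ≤ b → (0 , l) ∈ points (extend p s a≤b)
extend-points₀⁺ done s a≤b a≤l l≤b = there (points₀⁺ (vertical a≤b) a≤l l≤b)
extend-points₀⁺ (up p) s a≤b a≤l l≤b = there (extend-points₀⁺ p s a≤b a≤l l≤b)
extend-points₀⁺ (across t p) s a≤b a≤l l≤b = there (extend-points₀⁺ p s a≤b a≤l l≤b)

-- Families of paths built from chains.

-- The i-th path starts at (x + i , 0) and ends at (0 , bᵢ).
Paths : ℕ → Vec ℕ m → Set
Paths x [] = ⊤
Paths x (b ∷ B) = Path b x 0 × Paths (suc x) B

extends : (E A : Vec ℕ m) (b : ℕ) (B : Vec ℕ m) →
  Paths x E → Moves E A → Interlaced A (b ∷ B) → Paths (suc x) B
extends [] [] b [] _ _ _ = tt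
extends (e ∷ E) (a ∷ A) b (b′ ∷ B) (p , ps) (s , t) ((_ , a<b′) , i) =
  -- The true entry height is `suc a`, so `a<b′` is the bound required by `extend`.
  extend p s a<b′ , extends E A b′ B ps t i

build : ∀ m (B : Vec ℕ m) → Chain m B → Paths 0 B
build zero [] _ = tt
build (suc m) (b ∷ B) (E , c , A , t , i) = vertical z≤n , extends E A b B (build m E c) t i

-- The input of `extends` as one dependent tuple, so that injectivity is a single equation.
Layer : ℕ → Vec ℕ (suc m) → Set
Layer {m} x B = Σ[ E ∈ Vec ℕ m ] Paths x E × (Σ[ A ∈ Vec ℕ m ] Moves E A × Interlaced A B)

extends-injective : (E A E′ A′ : Vec ℕ m) (b : ℕ) (B : Vec ℕ m)
  (ps : Paths x E) (t : Moves E A) (i : Interlaced A (b ∷ B))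
  (ps′ : Paths x E′) (t′ : Moves E′ A′) (i′ : Interlaced A′ (b ∷ B)) →
  extends E A b B ps t i ≡ extends E′ A′ b B ps′ t′ i′ →
  _≡_ {A = Layer x (b ∷ B)} (E , ps , A , t , i) (E′ , ps′ , A′ , t′ , i′)
extends-injective [] [] [] [] b [] _ _ _ _ _ _ _ = refl
extends-injective (e ∷ E) (a ∷ A) (e′ ∷ E′) (a′ ∷ A′) b (b′ ∷ B)
  (p , ps) (s , t) ((b≤a , a<b′) , i) (p′ , ps′) (s′ , t′) ((b≤a′ , a′<b′) , i′) eq
  with refl ← trans (sym (strip-extend p s a<b′))
                (trans (cong strip (cong proj₁ eq)) (strip-extend p′ s′ a′<b′))
  with refl ← extends-injective E A E′ A′ b′ B ps t i ps′ t′ i′ (cong proj₂ eq)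
  with refl ← ≤-irrelevant b≤a b≤a′ = refl

build-injective : ∀ m (B : Vec ℕ m) {c c′ : Chain m B} → build m B c ≡ build m B c′ → c ≡ c′
build-injective zero [] _ = refl
build-injective (suc m) (b ∷ B) {E , c , A , t , i} {E′ , c′ , A′ , t′ , i′} eq =
  unlayer refl refl
    (extends-injective E A E′ A′ b B (build m E c) t i (build m E′ c′) t′ i′ (cong proj₂ eq))
  where
  -- The built families are generalised to variables, which lets the equation of tuples be matched
  -- with `refl`.
  unlayer : ∀ {ps ps′} → ps ≡ build m E c → ps′ ≡ build m E′ c′ →
    _≡_ {A = Layer 0 (b ∷ B)} (E , ps , A , t , i) (E′ , ps′ , A′ , t′ , i′) →
    _≡_ {A = Chain (suc m) (b ∷ B)} (E , c , A , t , i) (E′ , c′ , A′ , t′ , i′)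
  unlayer eq₁ eq₂ refl =
    cong (λ d → E , d , A , t , i) (build-injective m E (trans (sym eq₁) eq₂))

-- Recovering the chain of a disjoint family.

Apart : List (ℕ × ℕ) → List (ℕ × ℕ) → Set
Apart P Q = ∀ {k l} → (k , l) ∈ P → (k , l) ∈ Q → ⊥

-- Only neighbouring paths are compared; this already suffices to reconstruct the chain.
Separate : (B : Vec ℕ m) → Paths x B → Set
Separate [] _ = ⊤
Separate (b ∷ []) _ = ⊤
Separate (b ∷ b′ ∷ B) (p , q , ps) = Apart (points p) (points q) × Separate (b′ ∷ B) (q , ps)

separate-tail : (B : Vec ℕ m) {p : Path b x 0} {ps : Paths (suc x) B} →
  Separate (b ∷ B) (p , ps) → Separate B ps
separate-tail [] _ = tt
separate-tail (_ ∷ _) (_ , sep) = sep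

separate-extends⁻ : (E A : Vec ℕ m) (b : ℕ) (B : Vec ℕ m)
  (ps : Paths x E) (t : Moves E A) (i : Interlaced A (b ∷ B)) →
  Separate B (extends E A b B ps t i) → Separate E ps
separate-extends⁻ [] [] b [] _ _ _ _ = tt
separate-extends⁻ (e ∷ []) (a ∷ []) b (b₁ ∷ []) _ _ _ _ = tt
separate-extends⁻ (e ∷ e₁ ∷ E) (a ∷ a₁ ∷ A) b (b₁ ∷ b₂ ∷ B)
  (p , q , ps) (s , s₁ , t) ((_ , a<b₁) , (b₁≤a₁ , a₁<b₂) , i) (apart , sep) =
  (λ z w → apart (extend-points⁺ p s a<b₁ z) (extend-points⁺ q s₁ a₁<b₂ w)) ,
  separate-extends⁻ (e₁ ∷ E) (a₁ ∷ A) b₁ (b₂ ∷ B) (q , ps) (s₁ , t) ((b₁≤a₁ , a₁<b₂) , i) sep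

↝-lower : b ↝ suc a → a ≤ b
↝-lower left = n≤1+n _
↝-lower diag = ≤-refl

↝-upper : b ↝ suc a → b ≤ suc a
↝-upper left = ≤-refl
↝-upper diag = n≤1+n _

-- For neighbours, `e ≤ suc a ≤ a₁ ≤ e₁`, and equality of `e` and `e₁` would give both paths the
-- same end.
separate-increasing : ∀ {lo} (E A : Vec ℕ m) (ps : Paths x E) → Separate E ps → Moves E A →
  IncreasingFrom lo A → IncreasingFrom lo E
separate-increasing [] [] _ _ _ _ = tt
separate-increasing (e ∷ []) (a ∷ []) _ _ (s , _) (lo≤a , _) = ≤-trans lo≤a (↝-lower s) , tt
separate-increasing (e ∷ e₁ ∷ E) (a ∷ a₁ ∷ A) (p , q , ps) (apart , sep) (s , s₁ , t)
  (lo≤a , a<a₁ , inc) =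
  ≤-trans lo≤a (↝-lower s) , e<e₁ ,
  proj₂ (separate-increasing (e₁ ∷ E) (a₁ ∷ A) (q , ps) sep (s₁ , t) (a<a₁ , inc))
  where
  e<e₁ : e < e₁
  e<e₁ = ≤∧≢⇒< (≤-trans (↝-upper s) (≤-trans a<a₁ (↝-lower s₁)))
    (λ { refl → apart (end∈points p) (end∈points q) })

-- Stripping every path yields `E`, `A` and `Moves`. The upper bounds in `Interlaced` hold along
-- each path; the lower ones come from disjointness of neighbours.
peel : ∀ {lo} (B : Vec ℕ m) (p : Path b x 0) (ps : Paths (suc x) B) →
  Separate (b ∷ B) (p , ps) → IncreasingFrom lo (b ∷ B) →
  Σ[ E ∈ Vec ℕ m ] Σ[ A ∈ Vec ℕ m ] Σ[ qs ∈ Paths x E ]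
  Σ[ t ∈ Moves E A ] Σ[ i ∈ Interlaced A (b ∷ B) ] extends E A b B qs t i ≡ ps
peel [] _ _ _ _ = [] , [] , tt , tt , tt , refl
peel {b = b} (b₁ ∷ B) p (q , ps) (apart , sep) (_ , b<b₁ , inc)
  with strip q | extend-strip q
... | e , a , q′ , s , a≤b₁ | refl with a ≤? b
-- In column 0 the path `q` covers all heights from `a` to `b₁`, so it would contain the end (0, b)
-- of `p`.
...   | yes a≤b = ⊥-elim (apart (end∈points p) (extend-points₀⁺ q′ s a≤b₁ a≤b (<⇒≤ b<b₁)))
...   | no a≰b with s≤s b≤a ← ≰⇒> a≰b
           with E , A , qs , t , i , refl ← peel B q ps sep (b<b₁ , inc) =
        e ∷ E , _ ∷ A , (q′ , qs) , (s , t) , ((b≤a , a≤b₁) , i) , refl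

build-surjective : ∀ m (B : Vec ℕ m) (ps : Paths 0 B) → IncreasingFrom 0 B → Separate B ps →
  Σ[ c ∈ Chain m B ] build m B c ≡ ps
build-surjective zero [] _ _ _ = tt , refl
build-surjective (suc m) (b ∷ B) (p , ps) inc sep
  with E , A , qs , t , i , refl ← peel B p ps sep inc
  with sepE ← separate-extends⁻ E A b B qs t i (separate-tail B sep)
  with c , refl ← build-surjective m E qs
         (separate-increasing E A qs sepE t (interlaced-source A (b ∷ B) i)) sepE =
  (E , c , A , t , i) , cong (_, _) (path₀-irrelevant _ p)

-- Disjointness of the families built from chains.

Above : List (ℕ × ℕ) → (B : Vec ℕ m) → Paths x B → Set
Above P [] _ = ⊤
Above P (b ∷ B) (q , qs) =
  (∀ {k l l′} → (k , l) ∈ P → (k , l′) ∈ points q → l < l′) × Above P B qs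

-- The invariant carried through `extends`: in every column, earlier paths lie strictly below later
-- ones. Disjointness follows at the end.
Ordered : (B : Vec ℕ m) → Paths x B → Set
Ordered [] _ = ⊤
Ordered (b ∷ B) (p , ps) = Above (points p) B ps × Ordered B ps

-- In column 0, `Q` stays at or below `c ≤ b ≤ a`, under the entry height `suc a`; elsewhere it is
-- `P` shifted. Arbitrary lists cover both an extended path and the new vertical path, where `P` is
-- empty.
above-extends : ∀ {c} {P Q : List (ℕ × ℕ)} (E A : Vec ℕ m) (b : ℕ) (B : Vec ℕ m)
  (ps : Paths x E) (t : Moves E A) (i : Interlaced A (b ∷ B)) → c ≤ b →
  (∀ {k l} → (k , l) ∈ Q → (k ≡ 0 × l ≤ c) ⊎ (Σ[ j ∈ ℕ ] k ≡ suc j × (j , l) ∈ P)) →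
  Above P E ps → Above Q B (extends E A b B ps t i)
above-extends [] [] b [] _ _ _ _ _ _ = tt
above-extends {c = c} {P} {Q} (e ∷ E) (a ∷ A) b (b₁ ∷ B) (p , ps) (s , t) ((b≤a , a<b₁) , i)
  c≤b cover (P<p , above) =
  below , above-extends E A b₁ B ps t i (≤-trans c≤b (<⇒≤ (≤-<-trans b≤a a<b₁))) cover above
  where
  below : ∀ {k l l′} → (k , l) ∈ Q → (k , l′) ∈ points (extend p s a<b₁) → l < l′
  below z w with cover z | extend-points⁻ p s a<b₁ w
  ... | inj₁ (refl , l≤c) | inj₁ (_ , a<l′ , _) = ≤-<-trans (≤-trans l≤c (≤-trans c≤b b≤a)) a<l′
  ... | inj₁ (refl , _) | inj₂ (_ , () , _)
  ... | inj₂ (_ , refl , _) | inj₁ (() , _)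
  ... | inj₂ (_ , refl , z′) | inj₂ (_ , refl , w′) = P<p z′ w′

ordered-extends : (E A : Vec ℕ m) (b : ℕ) (B : Vec ℕ m)
  (ps : Paths x E) (t : Moves E A) (i : Interlaced A (b ∷ B)) →
  Ordered E ps → Ordered B (extends E A b B ps t i)
ordered-extends [] [] b [] _ _ _ _ = tt
ordered-extends (e ∷ E) (a ∷ A) b (b₁ ∷ B) (p , ps) (s , t) ((_ , a<b₁) , i) (above , ord) =
  above-extends E A b₁ B ps t i ≤-refl cover above , ordered-extends E A b₁ B ps t i ord
  where
  cover : ∀ {k l} → (k , l) ∈ points (extend p s a<b₁) →
    (k ≡ 0 × l ≤ b₁) ⊎ (Σ[ j ∈ ℕ ] k ≡ suc j × (j , l) ∈ points p)
  cover z with extend-points⁻ p s a<b₁ z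
  ... | inj₁ (k≡0 , _ , l≤b₁) = inj₁ (k≡0 , l≤b₁)
  ... | inj₂ w = inj₂ w

above-[] : (B : Vec ℕ m) (ps : Paths x B) → Above [] B ps
above-[] [] _ = tt
above-[] (b ∷ B) (_ , ps) = (λ ()) , above-[] B ps

build-ordered : ∀ m (B : Vec ℕ m) (c : Chain m B) → Ordered B (build m B c)
build-ordered zero [] _ = tt
build-ordered (suc m) (b ∷ B) (E , c , A , t , i) =
  above-extends E A b B (build m E c) t i ≤-refl cover (above-[] E (build m E c)) ,
  ordered-extends E A b B (build m E c) t i (build-ordered m E c)
  where
  cover : ∀ {k l} → (k , l) ∈ points (vertical {b = b} z≤n) →
    (k ≡ 0 × l ≤ b) ⊎ (Σ[ j ∈ ℕ ] k ≡ suc j × (j , l) ∈ [])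
  cover z with k≡0 , _ , l≤b ← points₀⁻ (vertical z≤n) z = inj₁ (k≡0 , l≤b)

-- The Schröder condition.

Schröder : (B : Vec ℕ m) → Paths x B → Set
Schröder [] _ = ⊤
Schröder {x = x} (b ∷ B) (p , ps) =
  (∀ {k l} → (k , l) ∈ points p → x ≤ k + l) × Schröder B ps

-- In column 0 the heights are at least `suc a`, and `x ≤ a` because `A` increases from `x`.
-- Elsewhere the shift raises both `k + l` and its bound by 1.
schröder-extends : (E A : Vec ℕ m) (b : ℕ) (B : Vec ℕ m)
  (ps : Paths x E) (t : Moves E A) (i : Interlaced A (b ∷ B)) →
  IncreasingFrom x A → Schröder E ps → Schröder B (extends E A b B ps t i)
schröder-extends [] [] b [] _ _ _ _ _ = tt
schröder-extends {x = x} (e ∷ E) (a ∷ A) b (b₁ ∷ B) (p , ps) (s , t) ((_ , a<b₁) , i)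
  (x≤a , inc) (high , sch) =
  high′ , schröder-extends E A b₁ B ps t i (increasing-weaken A (s≤s x≤a) inc) sch
  where
  high′ : ∀ {k l} → (k , l) ∈ points (extend p s a<b₁) → suc x ≤ k + l
  high′ z with extend-points⁻ p s a<b₁ z
  ... | inj₁ (refl , a<l , _) = ≤-<-trans x≤a a<l
  ... | inj₂ (_ , refl , w) = s≤s (high w)

build-schröder : ∀ m (B : Vec ℕ m) (c : Chain m B) → Schröder B (build m B c)
build-schröder zero [] _ = tt
build-schröder (suc m) (b ∷ B) (E , c , A , t , i) =
  (λ _ → z≤n) ,
  schröder-extends E A b B (build m E c) t i (interlaced-source A (b ∷ B) i) (build-schröder m E c)

-- Integer points

embed : ℕ × ℕ → Point
embed (k , l) = ℤ.+ k , ℤ.+ l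

embed-injective : ∀ {p q} → embed p ≡ embed q → p ≡ q
embed-injective refl = refl

toPoints : Path b x y → List⁺ Point
toPoints {x = x} {y} p = embed (x , y) ∷ map embed (rest p)

i≡[i-j]+j : ∀ i j → i ≡ (i ℤ.- j) ℤ.+ j
i≡[i-j]+j i j = sym (trans (ℤ.+-assoc i (ℤ.- j) j)
  (trans (cong (λ z → i ℤ.+ z) (ℤ.+-inverseˡ j)) (ℤ.+-identityʳ i)))

[i+j]-j≡i : ∀ i j → (i ℤ.+ j) ℤ.- j ≡ i
[i+j]-j≡i i j = trans (ℤ.+-assoc i j (ℤ.- j))
  (trans (cong (λ z → i ℤ.+ z) (ℤ.+-inverseʳ j)) (ℤ.+-identityʳ i))

n-[1+n]≡-1 : ∀ n → ℤ.+ n ℤ.- ℤ.+ suc n ≡ ℤ.-[1+ 0 ]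
n-[1+n]≡-1 n = trans (cong (λ z → z ℤ.- ℤ.+ suc n) (sym (ℤ.+-identityˡ (ℤ.+ n))))
  ([i+j]-j≡i ℤ.-[1+ 0 ] (ℤ.+ suc n))

-- With `d` on the left of the sums, each of the three steps from an embedded point computes to
-- constructor form.
-ᵖ-solve : ∀ (p q : Point) {d : Point} → q -ᵖ p ≡ d →
  q ≡ (proj₁ d ℤ.+ proj₁ p , proj₂ d ℤ.+ proj₂ p)
-ᵖ-solve (x , y) (x′ , y′) refl = cong₂ _,_ (i≡[i-j]+j x′ x) (i≡[i-j]+j y′ y)

step-up : ∀ x y → Step (embed (x , y)) (embed (x , suc y))
step-up x y = here (cong₂ _,_ (ℤ.+-inverseʳ (ℤ.+ x)) ([i+j]-j≡i (ℤ.+ 1) (ℤ.+ y)))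

step-across : ∀ x {y y′} → y ↝ y′ → Step (embed (suc x , y)) (embed (x , y′))
step-across x {y} left = there (there (here (cong₂ _,_ (n-[1+n]≡-1 x) (ℤ.+-inverseʳ (ℤ.+ y)))))
step-across x {y} diag = there (here (cong₂ _,_ (n-[1+n]≡-1 x) ([i+j]-j≡i (ℤ.+ 1) (ℤ.+ y))))

points-linked : (p : Path b x y) → Linked Step (map embed (points p))
points-linked done = [-]
points-linked {x = x} {y} (up p) = step-up x y ∷ points-linked p
points-linked {x = suc x} (across s p) = step-across x s ∷ points-linked p

last-∷ : ∀ (p q : Point) P → last (p ∷ q ∷ P) ≡ last (q ∷ P)
last-∷ p q P with initLast P
... | [] = refl
... | _ ∷ʳ′ _ = refl

last-toPoints : (p : Path b x y) → last (toPoints p) ≡ (ℤ.+ 0 , ℤ.+ b)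
last-toPoints done = refl
last-toPoints (up p) = trans (last-∷ _ _ (map embed (rest p))) (last-toPoints p)
last-toPoints (across _ p) = trans (last-∷ _ _ (map embed (rest p))) (last-toPoints p)

-- No step raises the first coordinate, so a path that has left column 0 to the left never returns.
last-negative : ∀ k l P → Linked Step ((ℤ.-[1+ k ] , l) ∷ P) →
  ¬ (proj₁ (last ((ℤ.-[1+ k ] , l) ∷ P)) ≡ ℤ.+ 0)
last-negative k l [] _ ()
last-negative k l (q ∷ P) (s ∷ ss) eq rewrite last-∷ (ℤ.-[1+ k ] , l) q P with s
... | here d with refl ← -ᵖ-solve (ℤ.-[1+ k ] , l) q d = last-negative _ _ P ss eq
... | there (here d) with refl ← -ᵖ-solve (ℤ.-[1+ k ] , l) q d = last-negative _ _ P ss eq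
... | there (there (here d)) with refl ← -ᵖ-solve (ℤ.-[1+ k ] , l) q d = last-negative _ _ P ss eq

parse : ∀ x y P → Linked Step (embed (x , y) ∷ P) →
  last (embed (x , y) ∷ P) ≡ (ℤ.+ 0 , ℤ.+ b) → Σ[ p ∈ Path b x y ] map embed (rest p) ≡ P
parse x y [] _ refl = done , refl
parse x y (q ∷ P) (s ∷ ss) end rewrite last-∷ (embed (x , y)) q P with s
parse x y (q ∷ P) (s ∷ ss) end | here d
  with refl ← -ᵖ-solve (embed (x , y)) q d
  with p , refl ← parse x (suc y) P ss end = up p , refl
parse zero y (q ∷ P) (s ∷ ss) end | there (here d)
  with refl ← -ᵖ-solve (embed (zero , y)) q d = ⊥-elim (last-negative _ _ P ss (cong proj₁ end))
parse (suc x) y (q ∷ P) (s ∷ ss) end | there (here d)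
  with refl ← -ᵖ-solve (embed (suc x , y)) q d
  with p , refl ← parse x (suc y) P ss end = across diag p , refl
parse zero y (q ∷ P) (s ∷ ss) end | there (there (here d))
  with refl ← -ᵖ-solve (embed (zero , y)) q d = ⊥-elim (last-negative _ _ P ss (cong proj₁ end))
parse (suc x) y (q ∷ P) (s ∷ ss) end | there (there (here d))
  with refl ← -ᵖ-solve (embed (suc x , y)) q d
  with p , refl ← parse x y P ss end = across left p , refl

toPoints-isPath : (p : Path b x y) → IsPath (embed (x , y)) (embed (0 , b)) (toPoints p)
toPoints-isPath p = record
  { starts = refl ; ends = last-toPoints p ; steps = points-linked p }

isPath-toPoints : ∀ P → IsPath (embed (x , y)) (embed (0 , b)) P →
  Σ[ p ∈ Path b x y ] toPoints p ≡ P
isPath-toPoints (_ ∷ P) record { starts = refl ; ends = ends ; steps = steps }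
  with p , refl ← parse _ _ P steps ends = p , refl

-- The second point identifies the first step: `up` alone keeps the column, and `left` and `diag`
-- arrive at different heights.
points-injective : (p q : Path b x y) → points p ≡ points q → p ≡ q
points-injective done done _ = refl
points-injective done (up q) ()
points-injective (up p) done ()
points-injective (up p) (up q) eq = cong up (points-injective p q (∷-injectiveʳ eq))
points-injective (up p) (across s q) eq
  with () ← 1+n≢n (cong proj₁ (∷-injectiveˡ (∷-injectiveʳ eq)))
points-injective (across s p) (up q) eq
  with () ← 1+n≢n (sym (cong proj₁ (∷-injectiveˡ (∷-injectiveʳ eq))))
points-injective (across left p) (across left q) eq =
  cong (across left) (points-injective p q (∷-injectiveʳ eq))
points-injective (across left p) (across diag q) eq
  with () ← 1+n≢n (sym (cong proj₂ (∷-injectiveˡ (∷-injectiveʳ eq))))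
points-injective (across diag p) (across left q) eq
  with () ← 1+n≢n (cong proj₂ (∷-injectiveˡ (∷-injectiveʳ eq)))
points-injective (across diag p) (across diag q) eq =
  cong (across diag) (points-injective p q (∷-injectiveʳ eq))

toPoints-injective : (p q : Path b x y) → toPoints p ≡ toPoints q → p ≡ q
toPoints-injective p q eq = points-injective p q
  (map-injective embed-injective (cong toList eq))

-- Families as tuples of point sequences.

family : (B : Vec ℕ m) → Paths x B → Vec (List⁺ Point) m
family [] _ = []
family (b ∷ B) (p , ps) = toPoints p ∷ family B ps

family-injective : (B : Vec ℕ m) {ps qs : Paths x B} → family B ps ≡ family B qs → ps ≡ qs
family-injective [] _ = refl
family-injective (b ∷ B) {p , _} {q , _} eq =
  cong₂ _,_ (toPoints-injective p q (Vec.∷-injectiveˡ eq))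
    (family-injective B (Vec.∷-injectiveʳ eq))

-- `IsFamily` with an offset, for induction on `m`; the order `toℕ i + x` makes the case of the
-- first path reduce to `x`.
HasEnds : ℕ → Vec (List⁺ Point) m → Set
HasEnds {m} x F = (i : Fin m) →
  IsPath (ℤ.+ (toℕ i + x) , ℤ.+ 0) (ℤ.+ 0 , ℤ.+ (toℕ i + x)) (lookup F i)

family-hasEnds : ∀ x m (ps : Paths x (range x m)) → HasEnds x (family (range x m) ps)
family-hasEnds x (suc m) (p , ps) zero = toPoints-isPath p
family-hasEnds x (suc m) (p , ps) (suc i) =
  subst (λ k → IsPath (ℤ.+ k , ℤ.+ 0) (ℤ.+ 0 , ℤ.+ k) (lookup (family (range (suc x) m) ps) i))
    (+-suc (toℕ i) x) (family-hasEnds (suc x) m ps i)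

hasEnds-family : ∀ x m (F : Vec (List⁺ Point) m) → HasEnds x F →
  Σ[ ps ∈ Paths x (range x m) ] family (range x m) ps ≡ F
hasEnds-family x zero [] _ = tt , refl
hasEnds-family x (suc m) (P ∷ F) ends
  with p , refl ← isPath-toPoints P (ends zero)
     | ps , refl ← hasEnds-family (suc x) m F (λ i →
         subst (λ k → IsPath (ℤ.+ k , ℤ.+ 0) (ℤ.+ 0 , ℤ.+ k) (lookup F i))
           (sym (+-suc (toℕ i) x)) (ends (suc i))) =
  (p , ps) , refl

hasEnds⇒isFamily : (F : Vec (List⁺ Point) m) → HasEnds 0 F → IsFamily F
hasEnds⇒isFamily F ends i =
  subst (λ k → IsPath (ℤ.+ k , ℤ.+ 0) (ℤ.+ 0 , ℤ.+ k) (lookup F i)) (+-identityʳ (toℕ i)) (ends i)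

isFamily⇒hasEnds : (F : Vec (List⁺ Point) m) → IsFamily F → HasEnds 0 F
isFamily⇒hasEnds F fam i =
  subst (λ k → IsPath (ℤ.+ k , ℤ.+ 0) (ℤ.+ 0 , ℤ.+ k) (lookup F i))
    (sym (+-identityʳ (toℕ i))) (fam i)

isDisjoint⇒separate : (B : Vec ℕ m) (ps : Paths x B) → IsDisjoint (family B ps) → Separate B ps
isDisjoint⇒separate [] _ _ = tt
isDisjoint⇒separate (b ∷ []) _ _ = tt
isDisjoint⇒separate (b ∷ b′ ∷ B) (p , q , ps) disj =
  (λ z w → disj zero (suc zero) (λ ()) (∈-map⁺ embed z , ∈-map⁺ embed w)) ,
  isDisjoint⇒separate (b′ ∷ B) (q , ps)
    (λ i j i≢j → disj (suc i) (suc j) (λ eq → i≢j (suc-injective eq)))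

above-disjoint : ∀ {P} (B : Vec ℕ m) (ps : Paths x B) → Above P B ps → ∀ i {z} →
  z ∈ map embed P → ¬ (z ∈ toList (lookup (family B ps) i))
above-disjoint (b ∷ B) (p , ps) (P<p , _) zero z∈P z∈p
  with _ , u , refl ← ∈-map⁻ embed z∈P | _ , v , refl ← ∈-map⁻ embed z∈p = <-irrefl refl (P<p u v)
above-disjoint (b ∷ B) (p , ps) (_ , above) (suc i) = above-disjoint B ps above i

ordered⇒isDisjoint : (B : Vec ℕ m) (ps : Paths x B) → Ordered B ps → IsDisjoint (family B ps)
ordered⇒isDisjoint (b ∷ B) _ _ zero zero 0≢0 _ = 0≢0 refl
ordered⇒isDisjoint (b ∷ B) (p , ps) (above , _) zero (suc j) _ (z , w) =
  above-disjoint B ps above j z w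
ordered⇒isDisjoint (b ∷ B) (p , ps) (above , _) (suc i) zero _ (z , w) =
  above-disjoint B ps above i w z
ordered⇒isDisjoint (b ∷ B) (p , ps) (_ , ord) (suc i) (suc j) i≢j =
  ordered⇒isDisjoint B ps ord i j (λ eq → i≢j (cong suc eq))

schröder⇒high : (B : Vec ℕ m) (ps : Paths x B) → Schröder B ps → ∀ i {k l} →
  (k , l) ∈ toList (lookup (family B ps) i) → k ℤ.+ l ℤ.≥ ℤ.+ (toℕ i + x)
schröder⇒high (b ∷ B) (p , ps) (high , _) zero z with _ , w , refl ← ∈-map⁻ embed z = ℤ.+≤+ (high w)
schröder⇒high {x = x} (b ∷ B) (p , ps) (_ , sch) (suc i) {k} {l} z =
  subst (λ n → k ℤ.+ l ℤ.≥ ℤ.+ n) (+-suc (toℕ i) x) (schröder⇒high B ps sch i z)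

range-increasing : ∀ x m → IncreasingFrom x (range x m)
range-increasing x zero = tt
range-increasing x (suc m) = ≤-refl , range-increasing (suc x) m

-- The bijection between families and chains.

module _ (n : ℕ) where

  chainFamily : Chain n (range 0 n) → Vec (List⁺ Point) n
  chainFamily c = family (range 0 n) (build n (range 0 n) c)

  chainFamily-injective : ∀ {c c′} → chainFamily c ≡ chainFamily c′ → c ≡ c′
  chainFamily-injective eq =
    build-injective n (range 0 n) (family-injective (range 0 n) eq)

  chainFamily-isDisjointSchröder : ∀ c → IsDisjointSchröderFamily (chainFamily c)
  chainFamily-isDisjointSchröder c = record
    { isFamily = hasEnds⇒isFamily (chainFamily c) (family-hasEnds 0 n ps)
    ; isDisjoint = ordered⇒isDisjoint B ps (build-ordered n B c)
    ; isSchröder = λ i k l z → subst (λ j → k ℤ.+ l ℤ.≥ ℤ.+ j) (+-identityʳ (toℕ i))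
        (schröder⇒high B ps (build-schröder n B c) i z)
    }
    where
    B = range 0 n
    ps = build n B c

  chainFamily-surjective : ∀ F → IsDisjointSchröderFamily F → Σ[ c ∈ _ ] chainFamily c ≡ F
  chainFamily-surjective F dsf
    with ps , refl ← hasEnds-family 0 n F
           (isFamily⇒hasEnds F (IsDisjointSchröderFamily.isFamily dsf))
    with c , refl ← build-surjective n (range 0 n) ps (range-increasing 0 n)
           (isDisjoint⇒separate (range 0 n) ps (IsDisjointSchröderFamily.isDisjoint dsf)) = c , refl

  -- Equality of families ignores the attached proofs, so the congruence of `to` and both inverse
  -- laws reduce to `from∘to` and injectivity of `chainFamily`.
  families↔chains : Inverse (DisjointSchröderFamilies n) (setoid (Chain n (range 0 n)))
  families↔chains = record
    { to = to
    ; from = from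
    ; to-cong = λ {F} {G} F≈G →
        chainFamily-injective (trans (from∘to F) (trans F≈G (sym (from∘to G))))
    ; from-cong = cong chainFamily
    ; inverse =
        (λ {c} {F} F≈ → chainFamily-injective (trans (from∘to F) F≈)) ,
        (λ {F} c≡ → trans (cong chainFamily c≡) (from∘to F))
    }
    where
    to : Σ (Vec (List⁺ Point) n) IsDisjointSchröderFamily → Chain n (range 0 n)
    to (F , dsf) = proj₁ (chainFamily-surjective F dsf)
    from : Chain n (range 0 n) → Σ (Vec (List⁺ Point) n) IsDisjointSchröderFamily
    from c = chainFamily c , chainFamily-isDisjointSchröder c
    from∘to : ∀ F → chainFamily (to F) ≡ proj₁ F
    from∘to (F , dsf) = proj₂ (chainFamily-surjective F dsf)

theorem2 : (n : ℕ) → Inverse (DisjointSchröderFamilies n) (setoid (Fin (2 ^ (n C 2))))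
theorem2 n = inverse (families↔chains n) (chain-count n)
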